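{- For every integer $n\geq 3$, $$\gamma_t(C_n\times C_3)=\left\lceil \frac{4n}{5}\right\rceil$$ and $$\gamma_p(C_n\times C_3)=\begin{cases}\left\lceil\frac{4n}{5}\right\rceil, & \text{if } n\equiv 0,2,4 \pmod 5,\\[2pt] \left\lceil\frac{4n}{5}\right\rceil+1, & \text{if } n\equiv 1,3 \pmod 5.\end{cases}$$
   Context: All graphs are finite, simple and undirected. $C_n$ denotes the cycle of order $n$ and $G\times H$ the Cartesian product of graphs. For a graph $G$ without isolated vertices: a set $D\subseteq V(G)$ is a total dominating set if every vertex of $G$ (including those in $D$) has a neighbour in $D$; $\gamma_t(G)$ is the minimum size of a total dominating set. A set $D\subseteq V(G)$ is a paired dominating set if every vertex outside $D$ has a neighbour in $D$ and the induced subgraph $G[D]$ has a perfect matching; $\gamma_p(G)$ is the minimum size of a paired dominating set. -}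

module Defs where

open import Data.Empty using (⊥)
open import Data.Fin.Base using (Fin; toℕ)
open import Data.List.Base using (List; length; allFin; cartesianProduct)
open import Data.List.Membership.Propositional using (_∈_; _∉_; mapWith∈)
open import Data.List.Membership.Propositional.Properties
  using (∈-allFin; ∈-cartesianProduct⁺)
open import Data.List.Relation.Unary.Any.Properties using (mapWith∈⁺)
open import Data.List.Relation.Unary.Enumerates.Setoid using (IsEnumeration)
open import Data.List.Relation.Unary.Unique.Propositional using (Unique)
open import Data.Nat.Base
  using (ℕ; zero; suc; _+_; _∸_; _/_; _≤_; s≤s; NonZero)
open import Data.Nat.Properties using (1+n≢n)
open import Data.Product using (∃; ∃!; _×_; _,_; proj₁)
open import Data.Sum.Base using (_⊎_; inj₁; inj₂; swap)
open import Level using (0ℓ)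
open import Relation.Binary.Core using (Rel; _⇒_)
open import Relation.Binary.Definitions using (Symmetric; Irreflexive)
open import Relation.Binary.PropositionalEquality
  using (_≡_; refl; sym; trans; cong; setoid)

-- Finite simple undirected graphs.  The list `vertices` only witnesses
-- finiteness; it may contain repetitions.
record Graph : Set₁ where
  field
    Vertex   : Set
    Adj      : Rel Vertex 0ℓ
    adj-sym  : Symmetric Adj
    adj-irr  : Irreflexive _≡_ Adj
    vertices : List Vertex
    complete : IsEnumeration (setoid Vertex) vertices

open Graph

-- `Next n i j` says j ≡ i + 1 (mod n).
Next : ∀ n → Rel (Fin n) 0ℓ
Next n i j = (toℕ j ≡ suc (toℕ i)) ⊎ (suc (toℕ i) ≡ n × toℕ j ≡ 0)

Next-irrefl : ∀ {n} → 3 ≤ n → (i : Fin n) → Next n i i → ⊥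
Next-irrefl _ i (inj₁ eq) = 1+n≢n (sym eq)
Next-irrefl {suc (suc (suc n))} _ i (inj₂ (eq , eq₀))
  with () ← trans (sym (cong suc eq₀)) eq
Next-irrefl {suc (suc zero)} (s≤s (s≤s ()))
Next-irrefl {suc zero} (s≤s ())

Cycle : ∀ n → 3 ≤ n → Graph
Cycle n 3≤n = record
  { Vertex   = Fin n
  ; Adj      = λ i j → Next n i j ⊎ Next n j i
  ; adj-sym  = swap
  ; adj-irr  = λ { refl (inj₁ p) → Next-irrefl 3≤n _ p
                 ; refl (inj₂ p) → Next-irrefl 3≤n _ p }
  ; vertices = allFin n
  ; complete = ∈-allFin
  }

infixr 7 _□_

-- The Cartesian product.
_□_ : Graph → Graph → Graph
G □ H = record
  { Vertex   = Vertex G × Vertex H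
  ; Adj      = λ (u , x) (v , y) → (u ≡ v × Adj H x y) ⊎ (Adj G u v × x ≡ y)
  ; adj-sym  = λ { (inj₁ (p , a)) → inj₁ (sym p , adj-sym H a)
                 ; (inj₂ (a , p)) → inj₂ (adj-sym G a , sym p) }
  ; adj-irr  = λ { refl (inj₁ (_ , a)) → adj-irr H refl a
                 ; refl (inj₂ (a , _)) → adj-irr G refl a }
  ; vertices = cartesianProduct (vertices G) (vertices H)
  ; complete = λ (u , x) → ∈-cartesianProduct⁺ (complete G u) (complete H x)
  }

-- Sets of vertices are duplicate-free lists, so that membership is
-- proof-irrelevant and the length is the cardinality.
record VertexSet (G : Graph) : Set where
  field
    elements : List (Vertex G)
    unique   : Unique elements

open VertexSet

size : ∀ {G} → VertexSet G → ℕ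
size D = length (elements D)

infix 4 _∈ᵥ_ _∉ᵥ_

_∈ᵥ_ : ∀ {G} → Vertex G → VertexSet G → Set
v ∈ᵥ D = v ∈ elements D

_∉ᵥ_ : ∀ {G} → Vertex G → VertexSet G → Set
v ∉ᵥ D = v ∉ elements D

_HasNeighbourIn_ : ∀ {G} → Vertex G → VertexSet G → Set
_HasNeighbourIn_ {G} v D = ∃ λ u → u ∈ᵥ D × Adj G v u

Induced : (G : Graph) → VertexSet G → Graph
Induced G D = record
  { Vertex   = ∃ λ v → v ∈ᵥ D
  ; Adj      = λ (u , _) (v , _) → Adj G u v
  ; adj-sym  = adj-sym G
  ; adj-irr  = λ eq → adj-irr G (cong proj₁ eq)
  ; vertices = mapWith∈ (elements D) (λ {v} v∈D → v , v∈D)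
  ; complete = λ (v , v∈D) → mapWith∈⁺ _ (v , v∈D , refl)
  }

-- A set M of edges, given as a symmetric subrelation of adjacency, such
-- that every vertex lies on exactly one edge of M.
record PerfectMatching (G : Graph) : Set₁ where
  field
    M         : Rel (Vertex G) 0ℓ
    M-sym     : Symmetric M
    M-edges   : M ⇒ Adj G
    M-perfect : ∀ v → ∃! _≡_ (M v)

IsTotalDominating : (G : Graph) → VertexSet G → Set
IsTotalDominating G D = ∀ v → v HasNeighbourIn D

IsPairedDominating : (G : Graph) → VertexSet G → Set₁
IsPairedDominating G D =
  (∀ v → v ∉ᵥ D → v HasNeighbourIn D) × PerfectMatching (Induced G D)

IsMinimumSize : ∀ {ℓ} (G : Graph) → (VertexSet G → Set ℓ) → ℕ → Set ℓ
IsMinimumSize G P k =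
  (∃ λ D → P D × size D ≡ k) × (∀ D → P D → k ≤ size D)

-- `γₜ[ G ]≡ k` and `γₚ[ G ]≡ k` say that the minimum defining the domination
-- parameter is attained and equals k.  They hold for no k if G has an
-- isolated vertex, where the parameters are undefined.
infix 4 γₜ[_]≡_ γₚ[_]≡_

γₜ[_]≡_ : Graph → ℕ → Set
γₜ[ G ]≡ k = IsMinimumSize G (IsTotalDominating G) k

γₚ[_]≡_ : Graph → ℕ → Set₁
γₚ[ G ]≡ k = IsMinimumSize G (IsPairedDominating G) k

⌈_/_⌉ : (m k : ℕ) .{{_ : NonZero k}} → ℕ
⌈ m / k ⌉ = (m + (k ∸ 1)) / k

-- Lower bound: let xᵢ be the number of chosen vertices in column i, a copy of
-- C₃.  If xᵢ = 0 then xᵢ₋₁ + xᵢ₊₁ ≥ 3, and if xᵢ = 1 then xᵢ₋₁ + xᵢ₊₁ ≥ 1.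
-- These local constraints alone force the average of x to be at least 4/5, as
-- certified by a potential φ with 4 + φ(xᵢ,xᵢ₊₁) ≤ 5xᵢ + φ(xᵢ₋₁,xᵢ), which
-- telescopes around the cycle.  A set with a perfect matching has even size,
-- which gives the extra vertex when ⌈4n/5⌉ is odd.
--
-- Upper bound: repeat the columns ∅ {1,2} ∅ {0} {0}, starting with at most four
-- further columns, all containing 0.  Adjacent columns {0} {0} are matched
-- horizontally and columns with two vertices vertically.
module Submission where

open import Data.Nat.Base
  using (ℕ; zero; suc; _+_; _*_; _%_; _≤_; _<_; z≤n; s≤s)
open import Data.Nat.Properties as ℕ using (≤-refl)
open import Data.Product.Base using (_×_)
open import Data.Sum.Base using (_⊎_)
open import Relation.Binary.PropositionalEquality using (_≡_)
open import Defs

open import Algebra.Properties.CommutativeMonoid.Sum ℕ.+-0-commutativeMonoid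
  using (sum; sum-syntax; sum-cong-≗; sum-replicate-zero;
         ∑-distrib-+; sum-permute)
open import Data.Bool.Base using (true; false; if_then_else_)
open import Data.Fin.Base using (Fin; zero; suc; toℕ; fromℕ; fromℕ<; inject₁)
open import Data.Fin.Patterns using (0F; 1F; 2F)
open import Data.Fin.Permutation using (Permutation′; permutation)
open import Data.Fin.Properties as Fin
  using (toℕ-injective; toℕ<n; toℕ-fromℕ; toℕ-fromℕ<; toℕ-inject₁; injective⇒≤)
open import Data.List.Base using (List; []; _∷_; [_]; _++_; length; lookup; map; filter)
open import Data.List.Membership.Propositional using (_∈_)
open import Data.List.Membership.Propositional.Properties
  using (∈-map⁺; ∈-map⁻; ∈-++⁺ˡ; ∈-++⁺ʳ; ∈-++⁻; ∈-∃++; ∈-filter⁺)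
open import Data.List.Membership.Propositional.Properties.WithK using (unique⇒irrelevant)
open import Data.List.Properties using (length-++; length-map)
open import Data.List.Relation.Binary.Permutation.Propositional using (_↭_; ↭-sym; ↭⇒↭ₛ; prep)
open import Data.List.Relation.Binary.Permutation.Propositional.Properties
  using (↭-length; ∈-resp-↭; shift)
open import Data.List.Relation.Binary.Permutation.Setoid.Properties using (Unique-resp-↭)
open import Data.List.Relation.Unary.All as All using ([]; _∷_)
open import Data.List.Relation.Unary.AllPairs using ([]; _∷_)
open import Data.List.Relation.Unary.Any using (here; there; index)
open import Data.List.Relation.Unary.Any.Properties using (lookup-index)
open import Data.List.Relation.Unary.Unique.Propositional using (Unique)
open import Data.List.Relation.Unary.Unique.Propositional.Properties using (map⁺; ++⁺)
open import Data.Nat.DivMod using (_/_; m<n*o⇒m/o<n; m*n/n≡m; /-monoˡ-≤)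
open import Data.Nat.Divisibility using (_∣_; divides; ∣m+n∣m⇒∣n; ∣m∣n⇒∣m+n; ∣1⇒≡1; ∣-refl)
open import Data.Product.Base using (∃; _,_; proj₁; proj₂; map₁)
open import Data.Product.Properties using (≡-dec)
open import Data.Sum.Base using (inj₁; inj₂; [_,_]′)
open import Function.Base using (_∘_; case_of_)
open import Level using (0ℓ)
open import Relation.Binary.Core using (Rel)
open import Relation.Binary.Definitions using (Symmetric; Irreflexive)
open import Relation.Binary.PropositionalEquality
  using (_≢_; refl; sym; trans; cong; cong₂; subst; setoid; module ≡-Reasoning)
open import Relation.Nullary using (yes; no; contradiction; does)

open Graph
open VertexSet

variable
  n : ℕ

-- Neighbours on a cycle

∃next : (i : Fin n) → ∃ (Next n i)
∃next {suc m} i with suc (toℕ i) ℕ.<? suc m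
... | yes i+1<n = fromℕ< i+1<n , inj₁ (toℕ-fromℕ< i+1<n)
... | no  i+1≮n = zero , inj₂ (ℕ.≤-antisym (toℕ<n i) (ℕ.≮⇒≥ i+1≮n) , refl)

∃prev : (i : Fin n) → ∃ λ j → Next n j i
∃prev {suc m} zero    = fromℕ m , inj₂ (cong suc (toℕ-fromℕ m) , refl)
∃prev         (suc i) = inject₁ i , inj₁ (cong suc (sym (toℕ-inject₁ i)))

next prev : Fin n → Fin n
next = proj₁ ∘ ∃next
prev = proj₁ ∘ ∃prev

next-Next : (i : Fin n) → Next n i (next i)
next-Next = proj₂ ∘ ∃next

prev-Next : (i : Fin n) → Next n (prev i) i
prev-Next = proj₂ ∘ ∃prev

-- The two clauses of `Next` exclude each other: wrapping around requires `suc (toℕ i)` to be `n`,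
-- which no index of `Fin n` attains.
Next-functional : {i j k : Fin n} → Next n i j → Next n i k → j ≡ k
Next-functional (inj₁ p)       (inj₁ q)       = toℕ-injective (trans p (sym q))
Next-functional (inj₁ p)       (inj₂ (q , _)) = contradiction (trans p q) (ℕ.<⇒≢ (toℕ<n _))
Next-functional (inj₂ (p , _)) (inj₁ q)       = contradiction (trans q p) (ℕ.<⇒≢ (toℕ<n _))
Next-functional (inj₂ (_ , p)) (inj₂ (_ , q)) = toℕ-injective (trans p (sym q))

Next-injective : {i j k : Fin n} → Next n i k → Next n j k → i ≡ j
Next-injective (inj₁ p)       (inj₁ q)       = toℕ-injective (ℕ.suc-injective (trans (sym p) q))
Next-injective (inj₁ p)       (inj₂ (_ , q)) = contradiction (trans (sym q) p) ℕ.0≢1+n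
Next-injective (inj₂ (_ , p)) (inj₁ q)       = contradiction (trans (sym p) q) ℕ.0≢1+n
Next-injective (inj₂ (p , _)) (inj₂ (q , _)) = toℕ-injective (ℕ.suc-injective (trans p (sym q)))

next-prev : (i : Fin n) → next (prev i) ≡ i
next-prev i = Next-functional (next-Next (prev i)) (prev-Next i)

prev-next : (i : Fin n) → prev (next i) ≡ i
prev-next i = Next-injective (prev-Next (next i)) (next-Next i)

rotation : Permutation′ n
rotation = permutation next prev next-prev prev-next

C₃ : Graph
C₃ = Cycle 3 ≤-refl

C₃-complete : ∀ {k l} → k ≢ l → Adj C₃ k l
C₃-complete {0F} {0F} k≢l = contradiction refl k≢l
C₃-complete {0F} {1F} _   = inj₁ (inj₁ refl)
C₃-complete {0F} {2F} _   = inj₂ (inj₂ (refl , refl))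
C₃-complete {1F} {0F} _   = inj₂ (inj₁ refl)
C₃-complete {1F} {1F} k≢l = contradiction refl k≢l
C₃-complete {1F} {2F} _   = inj₁ (inj₁ refl)
C₃-complete {2F} {0F} _   = inj₁ (inj₂ (refl , refl))
C₃-complete {2F} {1F} _   = inj₂ (inj₁ refl)
C₃-complete {2F} {2F} k≢l = contradiction refl k≢l

-- Counting

sum-mono-≤ : {f g : Fin n → ℕ} → (∀ i → f i ≤ g i) → sum f ≤ sum g
sum-mono-≤ {zero}  f≤g = z≤n
sum-mono-≤ {suc n} f≤g = ℕ.+-mono-≤ (f≤g zero) (sum-mono-≤ (f≤g ∘ suc))

sum-const : ∀ n c → ∑[ i < n ] c ≡ n * c
sum-const zero    c = refl
sum-const (suc n) c = cong (c +_) (sum-const n c)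

sum-*ˡ : ∀ c (f : Fin n → ℕ) → ∑[ i < n ] (c * f i) ≡ c * sum f
sum-*ˡ {zero}  c f = sym (ℕ.*-zeroʳ c)
sum-*ˡ {suc n} c f = trans (cong (c * f zero +_) (sum-*ˡ c (f ∘ suc)))
                           (sym (ℕ.*-distribˡ-+ c (f zero) _))

-- Reindexing along the rotation is what makes the potential telescope around the cycle.
sum-next : (f : Fin n → ℕ) → ∑[ i < n ] f (next i) ≡ sum f
sum-next f = sym (sum-permute f rotation)

fibre : {A : Set} → (A → Fin n) → List A → Fin n → List A
fibre f xs i = filter (λ x → f x Fin.≟ i) xs

sum-indicator : (j : Fin n) → ∑[ i < n ] (if does (j Fin.≟ i) then 1 else 0) ≡ 1
sum-indicator {suc n} zero    = cong suc (sum-replicate-zero n)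
sum-indicator         (suc j) = sum-indicator j

length-fibre-∷ : {A : Set} (f : A → Fin n) (x : A) (xs : List A) (i : Fin n) →
  length (fibre f (x ∷ xs) i) ≡ (if does (f x Fin.≟ i) then 1 else 0) + length (fibre f xs i)
length-fibre-∷ f x xs i with does (f x Fin.≟ i)
... | true  = refl
... | false = refl

sum-fibre : {A : Set} (f : A → Fin n) (xs : List A) → ∑[ i < n ] length (fibre f xs i) ≡ length xs
sum-fibre {n} f []       = sum-replicate-zero n
sum-fibre {n} f (x ∷ xs) = begin
  ∑[ i < n ] length (fibre f (x ∷ xs) i)
    ≡⟨ sum-cong-≗ (length-fibre-∷ f x xs) ⟩
  ∑[ i < n ] ((if does (f x Fin.≟ i) then 1 else 0) + length (fibre f xs i))
    ≡⟨ ∑-distrib-+ _ (length ∘ fibre f xs) ⟩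
  ∑[ i < n ] (if does (f x Fin.≟ i) then 1 else 0) + ∑[ i < n ] length (fibre f xs i)
    ≡⟨ cong₂ _+_ (sum-indicator (f x)) (sum-fibre f xs) ⟩
  1 + length xs ∎
  where open ≡-Reasoning

-- Sending `k` to a position where it occurs is injective, because looking up that position returns
-- `k`.
enumeration⇒≤-length : (xs : List (Fin n)) → (∀ k → k ∈ xs) → n ≤ length xs
enumeration⇒≤-length xs ∈xs = injective⇒≤ {f = index ∘ ∈xs} λ {k} {l} eq →
  trans (lookup-index (∈xs k)) (trans (cong (lookup xs) eq) (sym (lookup-index (∈xs l))))

∈⇒0<length : {A : Set} {x : A} {xs : List A} → x ∈ xs → 0 < length xs
∈⇒0<length {xs = _ ∷ _} _ = s≤s z≤n

-- Lower bounds

-- x y z are the sizes of three consecutive columns of a total dominating set.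
data Admissible : (x y z : ℕ) → Set where
  empty  : ∀ {x z} → 3 ≤ x + z → Admissible x 0 z
  single : ∀ {x z} → 1 ≤ x + z → Admissible x 1 z
  large  : ∀ {x y z} → Admissible x (2 + y) z

-- For `y` at most 1, a larger `x` leaves less to demand of the next column, and `φ x y` grows
-- accordingly. The inequality of `φ-decreases` is tight along the column sizes 0 2 0 1 1 of the
-- extremal pattern, which fixes the values at its five pairs up to a common constant.
φ : ℕ → ℕ → ℕ
φ _ (suc (suc (suc _))) = 0
φ _             2 = 5
φ 0             1 = 7
φ (suc _)       1 = 8
φ 0             0 = 4
φ 1             0 = 9
φ (suc (suc _)) 0 = 11

φ≤11 : ∀ x y → φ x y ≤ 11
φ≤11 0             0 = ℕ.m≤m+n 4 7
φ≤11 1             0 = ℕ.m≤m+n 9 2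
φ≤11 (suc (suc _)) 0 = ≤-refl
φ≤11 0             1 = ℕ.m≤m+n 7 4
φ≤11 (suc _)       1 = ℕ.m≤m+n 8 3
φ≤11 _             2 = ℕ.m≤m+n 5 6
φ≤11 _ (suc (suc (suc _))) = z≤n

φ-decreases : ∀ {x y z} → Admissible x y z → 4 + φ y z ≤ 5 * y + φ x y
φ-decreases {0} {z = suc (suc (suc _))} (empty _) = ≤-refl
φ-decreases {0} {z = 1} (empty (s≤s ()))
φ-decreases {0} {z = 2} (empty (s≤s (s≤s ())))
φ-decreases {1} {z = 0} (empty (s≤s ()))
φ-decreases {1} {z = 1} (empty (s≤s (s≤s ())))
φ-decreases {1} {z = 2} (empty _) = ≤-refl
φ-decreases {1} {z = suc (suc (suc _))} (empty _) = ℕ.m≤m+n 4 5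
φ-decreases {suc (suc _)} {z = 0} (empty _) = ℕ.m≤m+n 8 3
φ-decreases {suc (suc _)} {z = 1} (empty _) = ≤-refl
φ-decreases {suc (suc _)} {z = 2} (empty _) = ℕ.m≤m+n 9 2
φ-decreases {suc (suc _)} {z = suc (suc (suc _))} (empty _) = ℕ.m≤m+n 4 7
φ-decreases {0} {z = 1} (single _) = ≤-refl
φ-decreases {0} {z = 2} (single _) = ℕ.m≤m+n 9 3
φ-decreases {0} {z = suc (suc (suc _))} (single _) = ℕ.m≤m+n 4 8
φ-decreases {suc _} {z = 0} (single _) = ≤-refl
φ-decreases {suc _} {z = 1} (single _) = ℕ.m≤m+n 12 1
φ-decreases {suc _} {z = 2} (single _) = ℕ.m≤m+n 9 4
φ-decreases {suc _} {z = suc (suc (suc _))} (single _) = ℕ.m≤m+n 4 9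
-- `5 * 2 + φ x 2` equals 15 = 4 + 11, so the uniform bound on `φ` suffices; for larger columns
-- `5 * y` alone reaches 15.
φ-decreases {y = 2} {z} large = ℕ.+-monoʳ-≤ 4 (φ≤11 2 z)
φ-decreases {y = suc (suc (suc y))} {z} large = begin
  4 + φ (3 + y) z     ≤⟨ ℕ.+-monoʳ-≤ 4 (φ≤11 (3 + y) z) ⟩
  5 * 3               ≤⟨ ℕ.*-monoʳ-≤ 5 (ℕ.m≤m+n 3 y) ⟩
  5 * (3 + y)         ≡⟨ ℕ.+-identityʳ _ ⟨
  5 * (3 + y) + 0     ∎
  where open ℕ.≤-Reasoning

cyclic-average : (x : Fin n → ℕ) → (∀ i → Admissible (x (prev i)) (x i) (x (next i))) →
                 n * 4 ≤ 5 * sum x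
cyclic-average {n} x admissible = ℕ.+-cancelʳ-≤ (sum Φ) _ _ (begin
  n * 4 + sum Φ                           ≡⟨ cong (_+ sum Φ) (sum-const n 4) ⟨
  ∑[ i < n ] 4 + sum Φ                    ≡⟨ ∑-distrib-+ (λ _ → 4) Φ ⟨
  ∑[ i < n ] (4 + Φ i)                    ≤⟨ sum-mono-≤ (λ i → φ-decreases (admissible i)) ⟩
  ∑[ i < n ] (5 * x i + Φ⁻ i)             ≡⟨ ∑-distrib-+ (λ i → 5 * x i) Φ⁻ ⟩
  ∑[ i < n ] (5 * x i) + sum Φ⁻           ≡⟨ cong₂ _+_ (sum-*ˡ 5 x) (sym (sum-next Φ⁻)) ⟩
  -- `Φ⁻` is `Φ` shifted by one column: `prev (next i)` is `i`.
  5 * sum x + ∑[ i < n ] Φ⁻ (next i)      ≡⟨ cong (5 * sum x +_) (sum-cong-≗ λ i →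
                                               cong (λ j → φ (x j) (x (next i))) (prev-next i)) ⟩
  5 * sum x + sum Φ                       ∎)
  where
  open ℕ.≤-Reasoning
  Φ Φ⁻ : Fin n → ℕ
  Φ  i = φ (x i) (x (next i))
  Φ⁻ i = φ (x (prev i)) (x i)

-- Column sizes of a total dominating set

Prism : (n : ℕ) → 3 ≤ n → Graph
Prism n 3≤n = Cycle n 3≤n □ C₃

module _ (3≤n : 3 ≤ n) (D : VertexSet (Prism n 3≤n))
         (D-dominates : IsTotalDominating (Prism n 3≤n) D) where

  column : Fin n → List (Fin 3)
  column i = map proj₂ (fibre proj₁ (elements D) i)

  ∈-column : ∀ {i k} → (i , k) ∈ᵥ D → k ∈ column i
  ∈-column v∈D = ∈-map⁺ proj₂ (∈-filter⁺ (λ v → proj₁ v Fin.≟ _) v∈D refl)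

  -- A neighbour within the column lies in a different row, while a neighbour in an adjacent column
  -- lies in the same row.
  column-dominated : ∀ i k → (∃ λ l → l ∈ column i × k ≢ l) ⊎ k ∈ column (prev i) ++ column (next i)
  column-dominated i k with D-dominates (i , k)
  ... | (_ , l) , v∈D , inj₁ (refl , k~l) =
    inj₁ (l , ∈-column v∈D , λ k≡l → adj-irr C₃ k≡l k~l)
  ... | (j , _) , v∈D , inj₂ (inj₁ i→j , refl) =
    inj₂ (∈-++⁺ʳ (column (prev i)) (∈-column
      (subst (λ h → (h , k) ∈ᵥ D) (Next-functional i→j (next-Next i)) v∈D)))
  ... | (j , _) , v∈D , inj₂ (inj₂ j→i , refl) =
    inj₂ (∈-++⁺ˡ (∈-column
      (subst (λ h → (h , k) ∈ᵥ D) (Next-injective j→i (prev-Next i)) v∈D)))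

  columns-admissible : ∀ i → Admissible (length (column (prev i))) (length (column i))
                                        (length (column (next i)))
  columns-admissible i with column i | column-dominated i
  -- With nothing chosen in the column, all three rows must occur in the two adjacent columns.
  ... | [] | dominated = empty (subst (3 ≤_) (length-++ (column (prev i)))
        (enumeration⇒≤-length _ λ k → [ (λ ()) , (λ k∈ → k∈) ]′ (dominated k)))
  -- The only chosen vertex of the column cannot dominate itself, so its row occurs in an adjacent
  -- column.
  ... | l ∷ [] | dominated = single (subst (1 ≤_) (length-++ (column (prev i)))
        ([ (λ { (_ , here refl , l≢l) → contradiction refl l≢l }) , ∈⇒0<length ]′ (dominated l)))
  ... | _ ∷ _ ∷ _ | _ = large

  4n≤5|D| : 4 * n ≤ 5 * size D
  4n≤5|D| = begin
    4 * n
      ≡⟨ ℕ.*-comm 4 n ⟩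
    n * 4
      ≤⟨ cyclic-average (length ∘ column) columns-admissible ⟩
    5 * ∑[ i < n ] length (column i)
      ≡⟨ cong (5 *_) (sum-cong-≗ λ i → length-map proj₂ (fibre proj₁ (elements D) i)) ⟩
    5 * ∑[ i < n ] length (fibre proj₁ (elements D) i)
      ≡⟨ cong (5 *_) (sum-fibre proj₁ (elements D)) ⟩
    5 * size D
      ∎
    where open ℕ.≤-Reasoning

-- A vertex of `D` has its mate as a neighbour in `D`.
paired⇒total : (3≤n : 3 ≤ n) (D : VertexSet (Prism n 3≤n)) →
               IsPairedDominating (Prism n 3≤n) D → IsTotalDominating (Prism n 3≤n) D
paired⇒total 3≤n D (dominated , matching) v with v ∈? elements D
  where open import Data.List.Membership.DecPropositional (≡-dec Fin._≟_ Fin._≟_) using (_∈?_)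
... | no  v∉D = dominated v v∉D
... | yes v∈D with PerfectMatching.M-perfect matching (v , v∈D)
...   | (u , u∈D) , v~u , _ = u , u∈D , PerfectMatching.M-edges matching v~u

-- Perfect matchings: parity and construction

module _ {A : Set} {R : Rel A 0ℓ} (irrefl : Irreflexive _≡_ R) (symmetric : Symmetric R)
         (functional : ∀ {x y z} → R x y → R x z → y ≡ z) where

  -- Remove the head and its mate, then recurse. The rest `as ++ bs` is not a sublist term of the
  -- input, so the recursion runs on the length bound `m`.
  matched⇒even : ∀ m (xs : List A) → length xs ≤ m → Unique xs →
                 (∀ {x} → x ∈ xs → ∃ λ y → y ∈ xs × R x y) → 2 ∣ length xs
  matched⇒even _ [] _ _ _ = divides 0 refl
  matched⇒even (suc m) (x ∷ ys) (s≤s |ys|≤m) unq@(x∉ys ∷ _) mate with mate (here refl)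
  ... | _ , here refl , xRx = contradiction xRx (irrefl refl)
  ... | y , there y∈ys , xRy with ∈-∃++ y∈ys
  ...   | as , bs , refl = subst (2 ∣_) (sym (↭-length σ))
      (∣m∣n⇒∣m+n ∣-refl (matched⇒even m zs |zs|≤m zs-unique zs-mate))
    where
    zs = as ++ bs

    σ : x ∷ as ++ [ y ] ++ bs ↭ x ∷ y ∷ zs
    σ = prep x (shift y as bs)

    |zs|≤m : length zs ≤ m
    |zs|≤m = ℕ.≤-trans (ℕ.n≤1+n _) (subst (_≤ m) (↭-length (shift y as bs)) |ys|≤m)

    all-unique : Unique (x ∷ y ∷ zs)
    all-unique = Unique-resp-↭ (setoid A) (↭⇒↭ₛ σ) unq

    zs-unique : Unique zs
    zs-unique with _ ∷ _ ∷ u ← all-unique = u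

    zs-mate : ∀ {z} → z ∈ zs → ∃ λ w → w ∈ zs × R z w
    zs-mate {z} z∈zs with (_ ∷ x∉zs) ∷ y∉zs ∷ _ ← all-unique
                        | mate (∈-resp-↭ (↭-sym σ) (there (there z∈zs)))
    ... | w , w∈ , zRw with ∈-resp-↭ σ w∈
    -- The mate of `z` is neither `x` nor `y`: otherwise `z` would be `y` or `x` respectively, and
    -- neither occurs in `zs`.
    ...   | here refl =
      contradiction (functional xRy (symmetric zRw)) (All.lookup y∉zs z∈zs)
    ...   | there (here refl) =
      contradiction (functional (symmetric xRy) (symmetric zRw)) (All.lookup x∉zs z∈zs)
    ...   | there (there w∈zs) = w , w∈zs , zRw

-- `M` relates vertices bundled with membership proofs, and `R` forgets these proofs. As
-- `elements D` has no duplicates, the proofs are unique, which keeps `R` functional.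
perfect-matching⇒even : ∀ {G} (D : VertexSet G) → PerfectMatching (Induced G D) → 2 ∣ size D
perfect-matching⇒even {G} D matching =
  matched⇒even {R = R} irrefl (λ (p , q , m) → q , p , M-sym m) functional _ (elements D) ≤-refl (unique D)
    λ u∈D → let ((v , v∈D) , m , _) = M-perfect (_ , u∈D) in v , v∈D , u∈D , v∈D , m
  where
  open PerfectMatching matching

  R : Rel (Vertex G) 0ℓ
  R u v = ∃ λ u∈D → ∃ λ v∈D → M (u , u∈D) (v , v∈D)

  irrefl : Irreflexive _≡_ R
  irrefl u≡v (_ , _ , m) = adj-irr G u≡v (M-edges m)

  functional : ∀ {u v w} → R u v → R u w → v ≡ w
  functional (p , _ , m) (q , _ , m′) with refl ← unique⇒irrelevant (unique D) p q
    with _ , _ , uniq ← M-perfect (_ , p) = cong proj₁ (trans (sym (uniq m)) (uniq m′))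

-- The conditions on `f` concern only `D`, so `f` may take arbitrary values elsewhere.
involution⇒perfect-matching : ∀ {G} (D : VertexSet G) (f : Vertex G → Vertex G) →
  (∀ v → v ∈ᵥ D → f v ∈ᵥ D × Adj G v (f v) × f (f v) ≡ v) → PerfectMatching (Induced G D)
involution⇒perfect-matching {G} D f mated = record
  { M         = λ (u , _) (v , _) → v ≡ f u
  ; M-sym     = λ { {u , u∈D} refl → sym (proj₂ (proj₂ (mated u u∈D))) }
  ; M-edges   = λ { {u , u∈D} refl → proj₁ (proj₂ (mated u u∈D)) }
  ; M-perfect = λ (v , v∈D) → (f v , proj₁ (mated v v∈D)) , refl ,
      λ { {_ , p} refl → cong (f v ,_) (unique⇒irrelevant (unique D) _ p) }
  }

-- Constructions

-- The two empty columns are told apart by the side on which `vertical` lies; `left` and `right` are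
-- the halves of a horizontal pair.
data Column : Set where
  gap₁ vertical gap₂ left right odd : Column

infix 4 _⟶_
-- `left` has `right` as its only successor and `right` has `left` as its only predecessor, so
-- horizontal mates are found by `next` and `prev`.
data _⟶_ : Column → Column → Set where
  right→gap₁    : right ⟶ gap₁
  gap₁→vertical : gap₁ ⟶ vertical
  vertical→gap₂ : vertical ⟶ gap₂
  gap₂→left     : gap₂ ⟶ left
  left→right    : left ⟶ right
  right→left    : right ⟶ left
  right→odd     : right ⟶ odd
  odd→gap₁      : odd ⟶ gap₁
  odd→left      : odd ⟶ left

-- `Path q p n` lists the n columns after p on a walk from p to q.
infixr 5 _∷_
data Path (q : Column) : Column → ℕ → Set where
  []  : Path q q 0
  _∷_ : ∀ {p c} → p ⟶ c → Path q c n → Path q p (suc n)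

columnAt : ∀ {p q} → Path q p n → Fin n → Column
columnAt (_∷_ {c = c} _ _) zero    = c
columnAt (_ ∷ w)           (suc i) = columnAt w i

first-step : ∀ {p q} (w : Path q p n) (i : Fin n) → toℕ i ≡ 0 → p ⟶ columnAt w i
first-step (s ∷ _) zero _ = s

last-column : ∀ {p q} (w : Path q p n) (i : Fin n) → suc (toℕ i) ≡ n → columnAt w i ≡ q
last-column (_ ∷ [])      zero    _  = refl
last-column (_ ∷ w)       (suc i) eq = last-column w i (ℕ.suc-injective eq)

inner-step : ∀ {p q} (w : Path q p n) (i j : Fin n) → toℕ j ≡ suc (toℕ i) →
             columnAt w i ⟶ columnAt w j
inner-step (_ ∷ w) zero    (suc j) eq = first-step w j (ℕ.suc-injective eq)
inner-step (_ ∷ w) (suc i) (suc j) eq = inner-step w i j (ℕ.suc-injective eq)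

-- A closed walk lists its end `p` as the last column, and its first step leaves from `p`, so the
-- wrap-around is a step as well.
cyclic-step : ∀ {p} (w : Path p p n) {i j : Fin n} → Next n i j → columnAt w i ⟶ columnAt w j
cyclic-step w {i} {j} (inj₁ eq) = inner-step w i j eq
cyclic-step w {i} {j} (inj₂ (eq , eq₀)) =
  subst (_⟶ columnAt w j) (sym (last-column w i eq)) (first-step w j eq₀)

block : Path right right n → Path right right (5 + n)
block w = right→gap₁ ∷ gap₁→vertical ∷ vertical→gap₂ ∷ gap₂→left ∷ left→right ∷ w

-- The column `odd` occurs (once) exactly if n ≡ 1 or 3 (mod 5), where n = 3 + m.
circuit : ∀ m → Path right right (3 + m)
circuit 0 = right→odd ∷ odd→left ∷ left→right ∷ []
circuit 1 = right→left ∷ left→right ∷ right→left ∷ left→right ∷ []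
circuit 2 = block []
circuit 3 = right→odd ∷ odd→gap₁ ∷ gap₁→vertical ∷ vertical→gap₂ ∷ gap₂→left ∷ left→right ∷ []
circuit 4 = right→left ∷ left→right ∷ block []
circuit (suc (suc (suc (suc (suc m))))) = block (circuit m)

-- The vertices of an `odd` column are chosen as {0} for total domination and
-- as {0,1} for paired domination.
module Construction (oddRows : List (Fin 3)) (oddRows-unique : Unique oddRows)
                    (0∈oddRows : 0F ∈ oddRows) where

  rows : Column → List (Fin 3)
  rows gap₁     = []
  rows vertical = 1F ∷ 2F ∷ []
  rows gap₂     = []
  rows left     = [ 0F ]
  rows right    = [ 0F ]
  rows odd      = oddRows

  rows-unique : ∀ c → Unique (rows c)
  rows-unique gap₁     = []
  rows-unique vertical = ((λ ()) ∷ []) ∷ [] ∷ []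
  rows-unique gap₂     = []
  rows-unique left     = [] ∷ []
  rows-unique right    = [] ∷ []
  rows-unique odd      = oddRows-unique

  cells : ∀ {p q} → Path q p n → List (Fin n × Fin 3)
  cells []                = []
  cells (_∷_ {c = c} _ w) = map (zero ,_) (rows c) ++ map (map₁ suc) (cells w)

  cells-unique : ∀ {p q} (w : Path q p n) → Unique (cells w)
  cells-unique []                = []
  cells-unique (_∷_ {c = c} _ w) =
    ++⁺ (map⁺ (λ { refl → refl }) (rows-unique c)) (map⁺ (λ { refl → refl }) (cells-unique w))
      λ (v∈ , v∈′) → case (∈-map⁻ (zero ,_) v∈ , ∈-map⁻ (map₁ suc) v∈′) of
        λ { ((_ , _ , refl) , (_ , _ , ())) }

  ∈-cells⁺ : ∀ {p q} (w : Path q p n) {i k} → k ∈ rows (columnAt w i) → (i , k) ∈ cells w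
  ∈-cells⁺ (_ ∷ w)           {zero}  k∈ = ∈-++⁺ˡ (∈-map⁺ (zero ,_) k∈)
  ∈-cells⁺ (_∷_ {c = c} _ w) {suc i} k∈ =
    ∈-++⁺ʳ (map (zero ,_) (rows c)) (∈-map⁺ (map₁ suc) (∈-cells⁺ w k∈))

  ∈-cells⁻ : ∀ {p q} (w : Path q p n) {i k} → (i , k) ∈ cells w → k ∈ rows (columnAt w i)
  ∈-cells⁻ (_∷_ {c = c} _ w) v∈ with ∈-++⁻ (map (zero ,_) (rows c)) v∈
  ... | inj₁ v∈₁ with _ , k∈ , refl ← ∈-map⁻ (zero ,_) v∈₁ = k∈
  ... | inj₂ v∈₂ with _ , u∈ , refl ← ∈-map⁻ (map₁ suc) v∈₂ = ∈-cells⁻ w u∈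

  weight : ∀ {p q} → Path q p n → ℕ
  weight []                = 0
  weight (_∷_ {c = c} _ w) = length (rows c) + weight w

  length-cells : ∀ {p q} (w : Path q p n) → length (cells w) ≡ weight w
  length-cells []                = refl
  length-cells (_∷_ {c = c} _ w) = trans (length-++ (map (zero ,_) (rows c)))
    (cong₂ _+_ (length-map (zero ,_) (rows c))
               (trans (length-map (map₁ suc) (cells w)) (length-cells w)))

  -- Gaps receive row 0 from one side and rows 1, 2 from `vertical`. In `left`, `right` and `odd`
  -- columns, row 0 is dominated horizontally and the others by row 0; `0∈oddRows` covers both
  -- choices of `oddRows`.
  locally-dominated : ∀ {a b c} → a ⟶ b → b ⟶ c → ∀ k →
    (∃ λ l → l ∈ rows b × k ≢ l) ⊎ k ∈ rows a ⊎ k ∈ rows c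
  locally-dominated right→gap₁    gap₁→vertical 0F = inj₂ (inj₁ (here refl))
  locally-dominated odd→gap₁      gap₁→vertical 0F = inj₂ (inj₁ 0∈oddRows)
  locally-dominated _             gap₁→vertical 1F = inj₂ (inj₂ (here refl))
  locally-dominated _             gap₁→vertical 2F = inj₂ (inj₂ (there (here refl)))
  locally-dominated gap₁→vertical _             0F = inj₁ (1F , here refl , λ ())
  locally-dominated gap₁→vertical _             1F = inj₁ (2F , there (here refl) , λ ())
  locally-dominated gap₁→vertical _             2F = inj₁ (1F , here refl , λ ())
  locally-dominated vertical→gap₂ gap₂→left     0F = inj₂ (inj₂ (here refl))
  locally-dominated vertical→gap₂ _             1F = inj₂ (inj₁ (here refl))
  locally-dominated vertical→gap₂ _             2F = inj₂ (inj₁ (there (here refl)))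
  locally-dominated _             left→right    0F = inj₂ (inj₂ (here refl))
  locally-dominated _             left→right    1F = inj₁ (0F , here refl , λ ())
  locally-dominated _             left→right    2F = inj₁ (0F , here refl , λ ())
  locally-dominated left→right    _             0F = inj₂ (inj₁ (here refl))
  locally-dominated left→right    _             1F = inj₁ (0F , here refl , λ ())
  locally-dominated left→right    _             2F = inj₁ (0F , here refl , λ ())
  locally-dominated right→odd     _             0F = inj₂ (inj₁ (here refl))
  locally-dominated right→odd     _             1F = inj₁ (0F , 0∈oddRows , λ ())
  locally-dominated right→odd     _             2F = inj₁ (0F , 0∈oddRows , λ ())

  module _ {p} (3≤n : 3 ≤ n) (w : Path p p n) where

    chosen : VertexSet (Prism n 3≤n)
    chosen = record { elements = cells w ; unique = cells-unique w }

    size-chosen : size chosen ≡ weight w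
    size-chosen = length-cells w

    chosen-dominates : IsTotalDominating (Prism n 3≤n) chosen
    chosen-dominates (i , k)
      with locally-dominated (cyclic-step w (prev-Next i)) (cyclic-step w (next-Next i)) k
    ... | inj₁ (l , l∈ , k≢l) = (i , l) , ∈-cells⁺ w l∈ , inj₁ (refl , C₃-complete k≢l)
    ... | inj₂ (inj₁ k∈) = (prev i , k) , ∈-cells⁺ w k∈ , inj₂ (inj₂ (prev-Next i) , refl)
    ... | inj₂ (inj₂ k∈) = (next i , k) , ∈-cells⁺ w k∈ , inj₂ (inj₁ (next-Next i) , refl)

module Total  = Construction [ 0F ] ([] ∷ []) (here refl)
module Paired = Construction (0F ∷ 1F ∷ []) (((λ ()) ∷ []) ∷ [] ∷ []) (here refl)

-- The matching on the paired dominating set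

module _ {p} (3≤n : 3 ≤ n) (w : Path p p n) where

  open Paired

  -- Horizontal pairs keep the row and change the column; `vertical` and `odd` columns are matched
  -- internally. Values off the chosen set are defaults.
  mateColumn : Column → Fin n → Fin n
  mateColumn left  i = next i
  mateColumn right i = prev i
  mateColumn _     i = i

  mateRow : Column → Fin 3 → Fin 3
  mateRow vertical 1F = 2F
  mateRow vertical 2F = 1F
  mateRow odd      0F = 1F
  mateRow odd      1F = 0F
  mateRow _        k  = k

  mate : Fin n × Fin 3 → Fin n × Fin 3
  mate (i , k) = mateColumn (columnAt w i) i , mateRow (columnAt w i) k

  pairedSet : VertexSet (Prism n 3≤n)
  pairedSet = chosen 3≤n w

  after-left : ∀ {i} → columnAt w i ≡ left → columnAt w (next i) ≡ right
  after-left {i} eq with columnAt w i | eq | columnAt w (next i) | cyclic-step w (next-Next i)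
  ... | _ | refl | _ | left→right = refl

  before-right : ∀ {i} → columnAt w i ≡ right → columnAt w (prev i) ≡ left
  before-right {i} eq with columnAt w i | eq | columnAt w (prev i) | cyclic-step w (prev-Next i)
  ... | _ | refl | _ | left→right = refl

  Mated : Fin n × Fin 3 → Set
  Mated v = mate v ∈ᵥ pairedSet × Adj (Prism n 3≤n) v (mate v) × mate (mate v) ≡ v

  mated-vertically : ∀ {i k l c} → columnAt w i ≡ c → mateColumn c i ≡ i → mateRow c k ≡ l →
                     mateRow c l ≡ k → l ∈ rows c → k ≢ l → Mated (i , k)
  mated-vertically {i} {k} {l} eq eqᵢ refl eqₗ l∈ k≢l
    -- `mate (mate v)` reads the column twice: the first `eq` and `eqᵢ` evaluate the inner `mate`,
    -- which stays in column `i`, and the second pair the outer one.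
    rewrite eq | eqᵢ | eq | eqᵢ | eqₗ =
    ∈-cells⁺ w (subst (λ c → l ∈ rows c) (sym eq) l∈) , inj₁ (refl , C₃-complete k≢l) , refl

  mated : ∀ v → v ∈ᵥ pairedSet → Mated v
  mated (i , k) v∈D = go k (columnAt w i) refl (∈-cells⁻ w v∈D)
    where
    go : ∀ k c → columnAt w i ≡ c → k ∈ rows c → Mated (i , k)
    go 1F vertical eq _ = mated-vertically eq refl refl refl (there (here refl)) λ ()
    go 2F vertical eq _ = mated-vertically eq refl refl refl (here refl) λ ()
    go 0F odd      eq _ = mated-vertically eq refl refl refl (there (here refl)) λ ()
    go 1F odd      eq _ = mated-vertically eq refl refl refl (here refl) λ ()
    go 0F vertical eq (there (there ()))
    go 2F odd      eq (there (there ()))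
    -- The mate lies in a `right` column, where `mate` steps back by `prev`.
    go 0F left eq _ rewrite eq | after-left eq =
      ∈-cells⁺ w (subst (λ c → 0F ∈ rows c) (sym (after-left eq)) (here refl)) ,
      inj₂ (inj₁ (next-Next i) , refl) , cong (_, 0F) (prev-next i)
    go 0F right eq _ rewrite eq | before-right eq =
      ∈-cells⁺ w (subst (λ c → 0F ∈ rows c) (sym (before-right eq)) (here refl)) ,
      inj₂ (inj₂ (prev-Next i) , refl) , cong (_, 0F) (next-prev i)
    go (suc _) left  eq (there ())
    go (suc _) right eq (there ())

  chosen-paired : IsPairedDominating (Prism n 3≤n) pairedSet
  chosen-paired = (λ v _ → chosen-dominates 3≤n w v) , involution⇒perfect-matching pairedSet mate mated

-- Sizes

-- A block adds five columns and four vertices, so both sides grow by 20.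
4n≤5*total : ∀ m → 4 * (3 + m) ≤ 5 * Total.weight (circuit m)
4n≤5*total 0 = ℕ.m≤m+n 12 3
4n≤5*total 1 = ℕ.m≤m+n 16 4
4n≤5*total 2 = ≤-refl
4n≤5*total 3 = ℕ.m≤m+n 24 1
4n≤5*total 4 = ℕ.m≤m+n 28 2
4n≤5*total (suc (suc (suc (suc (suc m))))) = begin
  4 * (5 + (3 + m))                     ≡⟨ ℕ.*-distribˡ-+ 4 5 (3 + m) ⟩
  20 + 4 * (3 + m)                      ≤⟨ ℕ.+-monoʳ-≤ 20 (4n≤5*total m) ⟩
  20 + 5 * Total.weight (circuit m)     ≡⟨ ℕ.*-distribˡ-+ 5 4 (Total.weight (circuit m)) ⟨
  5 * (4 + Total.weight (circuit m))    ∎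
  where open ℕ.≤-Reasoning

5*total≤4n+4 : ∀ m → 5 * Total.weight (circuit m) ≤ 4 * (3 + m) + 4
5*total≤4n+4 0 = ℕ.m≤m+n 15 1
5*total≤4n+4 1 = ≤-refl
5*total≤4n+4 2 = ℕ.m≤m+n 20 4
5*total≤4n+4 3 = ℕ.m≤m+n 25 3
5*total≤4n+4 4 = ℕ.m≤m+n 30 2
5*total≤4n+4 (suc (suc (suc (suc (suc m))))) = begin
  5 * (4 + Total.weight (circuit m))    ≡⟨ ℕ.*-distribˡ-+ 5 4 (Total.weight (circuit m)) ⟩
  20 + 5 * Total.weight (circuit m)     ≤⟨ ℕ.+-monoʳ-≤ 20 (5*total≤4n+4 m) ⟩
  20 + (4 * (3 + m) + 4)                ≡⟨ cong (_+ 4) (ℕ.*-distribˡ-+ 4 5 (3 + m)) ⟨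
  4 * (5 + (3 + m)) + 4                 ∎
  where open ℕ.≤-Reasoning

-- When the circuit has an `odd` column, this makes `⌈ 4 * n / 5 ⌉ + 1` even.
2∣paired : ∀ m → 2 ∣ Paired.weight (circuit m)
2∣paired 0 = divides 2 refl
2∣paired 1 = divides 2 refl
2∣paired 2 = divides 2 refl
2∣paired 3 = divides 3 refl
2∣paired 4 = divides 3 refl
2∣paired (suc (suc (suc (suc (suc m))))) = ∣m∣n⇒∣m+n (divides 2 refl) (2∣paired m)

paired≡total : ∀ m → (3 + m) % 5 ≡ 0 ⊎ (3 + m) % 5 ≡ 2 ⊎ (3 + m) % 5 ≡ 4 →
               Paired.weight (circuit m) ≡ Total.weight (circuit m)
paired≡total 0 (inj₂ (inj₁ ()))
paired≡total 0 (inj₂ (inj₂ ()))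
paired≡total 1 _ = refl
paired≡total 2 _ = refl
paired≡total 3 (inj₂ (inj₁ ()))
paired≡total 3 (inj₂ (inj₂ ()))
paired≡total 4 _ = refl
-- `(8 + m) % 5` computes to `(3 + m) % 5`, so `r` is passed on unchanged.
paired≡total (suc (suc (suc (suc (suc m))))) r = cong (4 +_) (paired≡total m r)

paired≡total+1 : ∀ m → (3 + m) % 5 ≡ 1 ⊎ (3 + m) % 5 ≡ 3 →
                 Paired.weight (circuit m) ≡ Total.weight (circuit m) + 1
paired≡total+1 0 _ = refl
paired≡total+1 1 (inj₁ ())
paired≡total+1 1 (inj₂ ())
paired≡total+1 2 (inj₁ ())
paired≡total+1 2 (inj₂ ())
paired≡total+1 3 _ = refl
paired≡total+1 4 (inj₁ ())
paired≡total+1 4 (inj₂ ())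
paired≡total+1 (suc (suc (suc (suc (suc m))))) r = cong (4 +_) (paired≡total+1 m r)

-- Ceilings and the final bounds

⌈/5⌉-least : ∀ m s → m ≤ 5 * s → ⌈ m / 5 ⌉ ≤ s
⌈/5⌉-least m s m≤5s = ℕ.≤-pred (m<n*o⇒m/o<n (begin-strict
  m + 4      ≤⟨ ℕ.+-monoˡ-≤ 4 m≤5s ⟩
  5 * s + 4  <⟨ ℕ.+-monoʳ-< (5 * s) (ℕ.n<1+n 4) ⟩
  5 * s + 5  ≡⟨ ℕ.+-comm (5 * s) 5 ⟩
  5 + 5 * s  ≡⟨ cong (5 +_) (ℕ.*-comm 5 s) ⟩
  suc s * 5  ∎))
  where open ℕ.≤-Reasoning

⌈/5⌉-greatest : ∀ m s → 5 * s ≤ m + 4 → s ≤ ⌈ m / 5 ⌉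
⌈/5⌉-greatest m s 5s≤m+4 = begin
  s             ≡⟨ m*n/n≡m s 5 ⟨
  s * 5 / 5     ≡⟨ cong (_/ 5) (ℕ.*-comm s 5) ⟩
  5 * s / 5     ≤⟨ /-monoˡ-≤ 5 5s≤m+4 ⟩
  (m + 4) / 5   ∎
  where open ℕ.≤-Reasoning

total≡⌈4n/5⌉ : ∀ m → Total.weight (circuit m) ≡ ⌈ 4 * (3 + m) / 5 ⌉
total≡⌈4n/5⌉ m = ℕ.≤-antisym (⌈/5⌉-greatest (4 * (3 + m)) _ (5*total≤4n+4 m))
                              (⌈/5⌉-least (4 * (3 + m)) _ (4n≤5*total m))

-- If `a` were equal to `b`, both `a` and `a + 1` would be even, and 2 would divide 1.
even-above-odd : ∀ {a b} → 2 ∣ a + 1 → 2 ∣ b → a ≤ b → a + 1 ≤ b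
even-above-odd {a} {b} 2∣a+1 2∣b a≤b = subst (_≤ b) (ℕ.+-comm 1 a) (ℕ.≤∧≢⇒< a≤b
  λ { refl → contradiction (∣1⇒≡1 (∣m+n∣m⇒∣n 2∣a+1 2∣b)) λ () })

total-lower : (3≤n : 3 ≤ n) (D : VertexSet (Prism n 3≤n)) →
              IsTotalDominating (Prism n 3≤n) D → ⌈ 4 * n / 5 ⌉ ≤ size D
total-lower {n} 3≤n D dominates = ⌈/5⌉-least (4 * n) (size D) (4n≤5|D| 3≤n D dominates)

paired-lower : (3≤n : 3 ≤ n) (D : VertexSet (Prism n 3≤n)) →
               IsPairedDominating (Prism n 3≤n) D → ⌈ 4 * n / 5 ⌉ ≤ size D
paired-lower 3≤n D paired = total-lower 3≤n D (paired⇒total 3≤n D paired)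

theorem3p1 : ∀ (n : ℕ) (3≤n : 3 ≤ n) →
    γₜ[ Cycle n 3≤n □ Cycle 3 ≤-refl ]≡ ⌈ 4 * n / 5 ⌉
    × ((n % 5 ≡ 0 ⊎ n % 5 ≡ 2 ⊎ n % 5 ≡ 4) →
    γₚ[ Cycle n 3≤n □ Cycle 3 ≤-refl ]≡ ⌈ 4 * n / 5 ⌉)
    × ((n % 5 ≡ 1 ⊎ n % 5 ≡ 3) →
    γₚ[ Cycle n 3≤n □ Cycle 3 ≤-refl ]≡ (⌈ 4 * n / 5 ⌉ + 1))
theorem3p1 1 (s≤s ())
theorem3p1 2 (s≤s (s≤s ()))
theorem3p1 (suc (suc (suc m))) 3≤n =
  ( (Total.chosen 3≤n w , Total.chosen-dominates 3≤n w , trans (Total.size-chosen 3≤n w) (total≡⌈4n/5⌉ m))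
  , total-lower 3≤n )
  , (λ r → (D , D-paired , trans |D| (trans (paired≡total m r) (total≡⌈4n/5⌉ m))) , paired-lower 3≤n)
  , (λ r → let |D|≡⌈4n/5⌉+1 = trans (paired≡total+1 m r) (cong (_+ 1) (total≡⌈4n/5⌉ m)) in
       (D , D-paired , trans |D| |D|≡⌈4n/5⌉+1)
     -- The constructed set has even size `⌈ 4 * n / 5 ⌉ + 1`, so the total domination bound is odd
     -- and `D′`, of even size, must exceed it.
     , λ D′ paired → even-above-odd (subst (2 ∣_) |D|≡⌈4n/5⌉+1 (2∣paired m))
                                    (perfect-matching⇒even D′ (proj₂ paired))
                                    (paired-lower 3≤n D′ paired))
  where
  w        = circuit m
  D        = pairedSet 3≤n w
  D-paired = chosen-paired 3≤n w
  |D|      = Paired.size-chosen 3≤n w
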